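{- For any undirected unweighted graph $G$ on $n$ nodes and any pair set $P$ on $G$, there is a tiebreaking scheme $\rho_G$ such that $$\Big|\bigcup_{p \in P} \rho_G(p)\Big| = O\big(n^{2/3}|P|^{2/3} + n|P|^{1/3}\big).$$ In particular, $G, P$ admit a pairwise distance preserver with $O(n^{2/3}|P|^{2/3} + n|P|^{1/3})$ edges.
   Context: A pair set on $G=(V,E)$ is a set $P \subseteq V \times V$. A path tiebreaking scheme on $G$ is a function $\rho_G$ mapping each node pair $(u,v)$ to a shortest path in $G$ from $u$ to $v$. $\bigcup_{p\in P}\rho_G(p)$ is the subgraph formed by the edges of these paths, and $|H|$ denotes the number of edges of a subgraph $H$. A pairwise distance preserver of $G,P$ is a subgraph $H$ with $\delta_H(u,v)=\delta_G(u,v)$ for all $(u,v)\in P$, where $\delta$ denotes shortest-path distance. -}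

module Defs where

open import Data.Nat using (ℕ; _≤_; _<_; _+_; _*_; _^_)
open import Data.Fin using (Fin; toℕ)
open import Data.Bool using (Bool; true; false)
open import Data.List using (List; []; _∷_; _++_; length)
open import Data.List.Membership.Propositional using (_∈_)
open import Data.List.Relation.Unary.All using (All)
open import Data.List.Relation.Unary.Unique.Propositional using (Unique)
open import Data.Product using (Σ; ∃; ∃-syntax; _×_; _,_)
open import Data.Sum using (_⊎_)
open import Relation.Binary.PropositionalEquality using (_≡_)
open import Relation.Nullary using (¬_)

record Graph (n : ℕ) : Set where
  field
    Adj    : Fin n → Fin n → Bool
    sym    : ∀ u v → Adj u v ≡ Adj v u
    irrefl : ∀ u → Adj u u ≡ false
open Graph public

-- Walk G u v xs : xs is the vertex sequence of a walk in G from u to v.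
-- Its number of edges is length xs - 1.
data Walk {n : ℕ} (G : Graph n) : Fin n → Fin n → List (Fin n) → Set where
  here : ∀ {u} → Walk G u u (u ∷ [])
  step : ∀ {u w v xs} → Adj G u w ≡ true → Walk G w v xs → Walk G u v (u ∷ xs)

Reachable : ∀ {n} → Graph n → Fin n → Fin n → Set
Reachable G u v = ∃[ xs ] Walk G u v xs

IsShortestPath : ∀ {n} → Graph n → Fin n → Fin n → List (Fin n) → Set
IsShortestPath G u v xs =
  Walk G u v xs × (∀ ys → Walk G u v ys → length xs ≤ length ys)

-- Pair set: a duplicate-free list of node pairs.
Pair : ℕ → Set
Pair n = Fin n × Fin n

-- A path tiebreaking scheme (restricted to the pairs of P): every pair
-- (u,v) ∈ P is mapped to a shortest u-v path; if v is unreachable from u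
-- (no shortest path exists) it is mapped to the empty list (no edges).
IsTiebreaking : ∀ {n} → Graph n → List (Pair n) → (Pair n → List (Fin n)) → Set
IsTiebreaking G P ρ =
  ∀ {u v} → (u , v) ∈ P →
    (Reachable G u v → IsShortestPath G u v (ρ (u , v))) ×
    (¬ Reachable G u v → ρ (u , v) ≡ [])

Consecutive : ∀ {n} → Fin n → Fin n → List (Fin n) → Set
Consecutive a b xs = ∃[ ys ] ∃[ zs ] xs ≡ ys ++ (a ∷ b ∷ zs)

-- The undirected edge {a,b} (normalised as toℕ a < toℕ b) lies in
-- ⋃_{p ∈ P} ρ(p).
InUnion : ∀ {n} → List (Pair n) → (Pair n → List (Fin n)) → Pair n → Set
InUnion P ρ (a , b) =
  toℕ a < toℕ b ×
  ∃[ p ] (p ∈ P × (Consecutive a b (ρ p) ⊎ Consecutive b a (ρ p)))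

UnionSizeAtMost : ∀ {n} → List (Pair n) → (Pair n → List (Fin n)) → ℕ → Set
UnionSizeAtMost {n} P ρ K =
  ∀ (es : List (Pair n)) → Unique es → All (InUnion P ρ) es → length es ≤ K

{-# OPTIONS --safe #-}

-- Take an edge-minimal subgraph H of G preserving the distances of P.  Every edge e = (x → y) of H has an
-- owner (s , t) ∈ P such that y is the only neighbour of x in H that is closer to t.  Greedily choose disjoint
-- clusters of D ≈ b / n vertices with a common neighbour until every vertex has fewer than D unclustered
-- neighbours; at most n D ≤ 2 b edges have an unclustered end.  For the other m edges, consider the S pairs
-- (e , f) with the same owner and e before f on its geodesic.  Cauchy–Schwarz over the owners gives m² ≤ 2 |P| S.
-- Map (e , f) to (tail e , cluster of head f), which has at most n · n / D values.  If (e′ , f′) has the same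
-- image and e ≢ e′, then f, the vertex head f′ and the detour offset in {-2, …, 2} determine everything: two
-- solutions would provide a second geodesic avoiding an owned edge.  Hence there are at most 5 S + 5 m D
-- collisions, and Cauchy–Schwarz gives D S² ≤ 5 n² (S + m D).  If S ≤ m D this yields m³ = O(n²|P|²),
-- otherwise m² D = O(n²|P|).
module Submission where

open import Defs hiding (sym; here; step)
open import Data.Bool using (Bool; true; false; _∧_; not; if_then_else_)
import Data.Bool.Properties as Bool
open import Data.Empty using (⊥-elim)
open import Data.Fin using (Fin; zero; suc; toℕ; fromℕ<; inject≤; combine; remQuot)
import Data.Fin.Properties as Fin
open import Data.List using (List; []; _∷_; _++_; length; map; filter; lookup; cartesianProduct; allFin)
open import Data.List.Membership.Propositional using (_∈_; find)
open import Data.List.Membership.Propositional.Properties using (∈-lookup; ∈-filter⁺; ∈-filter⁻; ∈-allFin; ∈-cartesianProduct⁺; ∈-cartesianProduct⁻)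
open import Data.List.Membership.Setoid.Properties using (index-injective)
open import Data.List.Properties using (length-++; length-filter; length-tabulate; filter-++; ∷-injectiveˡ; ∷-injectiveʳ)
open import Data.List.Relation.Unary.All as All using (All; all?)
open import Data.List.Relation.Unary.All.Properties using (¬All⇒Any¬)
open import Data.List.Relation.Unary.AllPairs using (_∷_)
open import Data.List.Relation.Unary.Any using (here; there; index)
open import Data.List.Relation.Unary.Any.Properties using (lookup-index)
open import Data.List.Relation.Unary.Unique.Propositional using (Unique)
open import Data.List.Relation.Unary.Unique.Propositional.Properties using (filter⁺; cartesianProduct⁺; allFin⁺)
open import Data.Nat
open import Data.Nat.DivMod using (m/n*n≤m; m≡m%n+[m/n]*n; m%n<n)
open import Data.Nat.Induction using (<-rec)
open import Data.Nat.ListAction using () renaming (sum to sumᴸ)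
open import Data.Nat.Properties
open import Data.Nat.Solver using (module +-*-Solver)
open import Data.Product using (Σ; ∃; ∃-syntax; _×_; _,_; proj₁; proj₂; uncurry)
open import Data.Sum using (_⊎_; inj₁; inj₂)
open import Function using (_∘_)
open import Relation.Binary using (tri<; tri≈; tri>)
open import Relation.Binary.PropositionalEquality
open import Relation.Nullary using (¬_; Dec; yes; no; does; contradiction; ¬?)
open import Relation.Nullary.Decidable using (_×-dec_; _⊎-dec_; map′; dec-true; dec-false)
open import Relation.Unary using (Decidable)
open import Algebra.Properties.Semiring.Sum +-*-semiring using (sum; sum-cong-≗; ∑-distrib-+; *-distribˡ-sum; sum-replicate-zero)

private variable
  A : Set
  n j k : ℕ
  u v w a b : Fin n

-- Counting collisions

Unique-lookup : {xs : List A} → Unique xs → ∀ i j → lookup xs i ≡ lookup xs j → i ≡ j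
Unique-lookup (_ ∷ _) zero zero _ = refl
Unique-lookup (x≢ ∷ _) zero (suc j) eq = contradiction eq (All.lookup x≢ (∈-lookup j))
Unique-lookup (x≢ ∷ _) (suc i) zero eq = contradiction (sym eq) (All.lookup x≢ (∈-lookup i))
Unique-lookup (_ ∷ u) (suc i) (suc j) eq = cong suc (Unique-lookup u i j eq)

-- The code may use the membership proof, because later codes are built from facts known only about
-- members.
Unique-length : {xs : List A} → Unique xs → (code : ∀ x → x ∈ xs → Fin n) →
                (∀ {x y} (p : x ∈ xs) (q : y ∈ xs) → code x p ≡ code y q → x ≡ y) → length xs ≤ n
Unique-length u code inj =
  Fin.injective⇒≤ {f = λ i → code _ (∈-lookup i)}
    (λ {i} {j} eq → Unique-lookup u i j (inj (∈-lookup i) (∈-lookup j) eq))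

length-filter-¬ : {P : A → Set} (P? : Decidable P) (xs : List A) →
                  length xs ≡ length (filter P? xs) + length (filter (¬? ∘ P?) xs)
length-filter-¬ P? [] = refl
length-filter-¬ P? (x ∷ xs) with does (P? x)
... | true  = cong suc (length-filter-¬ P? xs)
... | false = trans (cong suc (length-filter-¬ P? xs)) (sym (+-suc _ _))

sum-mono : {c d : Fin n → ℕ} → (∀ i → c i ≤ d i) → sum c ≤ sum d
sum-mono {zero}  h = z≤n
sum-mono {suc n} h = +-mono-≤ (h zero) (sum-mono (h ∘ suc))

sum-const : ∀ n k → sum {n} (λ _ → k) ≡ n * k
sum-const zero    k = refl
sum-const (suc n) k = cong (k +_) (sum-const n k)

x≤y⇒2xy≤x²+y² : ∀ {x y} → x ≤ y → 2 * (x * y) ≤ x * x + y * y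
x≤y⇒2xy≤x²+y² {x} {y} x≤y = subst (λ z → 2 * (x * z) ≤ x * x + z * z) (m+[n∸m]≡n x≤y)
  (≤-trans (m≤m+n _ (d * d)) (≤-reflexive
    (solve 2 (λ x d → con 2 :* (x :* (x :+ d)) :+ d :* d := x :* x :+ (x :+ d) :* (x :+ d)) refl x d)))
  where
  open +-*-Solver
  d = y ∸ x

2xy≤x²+y² : ∀ x y → 2 * (x * y) ≤ x * x + y * y
2xy≤x²+y² x y with ≤-total x y
... | inj₁ x≤y = x≤y⇒2xy≤x²+y² x≤y
... | inj₂ y≤x = subst₂ _≤_ (cong (2 *_) (*-comm y x)) (+-comm (y * y) (x * x)) (x≤y⇒2xy≤x²+y² y≤x)

-- Cauchy-Schwarz against the constant vector, by induction; `2xy≤x²+y²` bounds each cross term.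
sum²≤ : (c : Fin n → ℕ) → sum c * sum c ≤ n * sum (λ i → c i * c i)
sum²≤ {zero}  c = z≤n
sum²≤ {suc n} c = begin
  (x + s) * (x + s)
    ≡⟨ solve 2 (λ x s → (x :+ s) :* (x :+ s) := x :* x :+ (con 2 :* (x :* s) :+ s :* s)) refl x s ⟩
  x * x + (2 * (x * s) + s * s)    ≤⟨ +-monoʳ-≤ (x * x) (+-mono-≤ cross (sum²≤ (c ∘ suc))) ⟩
  x * x + ((n * (x * x) + q) + n * q)
    ≡⟨ solve 3 (λ n x q → x :* x :+ ((n :* (x :* x) :+ q) :+ n :* q) := (x :* x :+ q) :+ n :* (x :* x :+ q)) refl n x q ⟩
  suc n * (x * x + q)              ∎
  where
  open ≤-Reasoning
  open +-*-Solver
  x = c zero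
  s = sum (c ∘ suc)
  q = sum (λ i → c (suc i) * c (suc i))
  cross : 2 * (x * s) ≤ n * (x * x) + q
  cross = begin
    2 * (x * s)                                 ≡⟨ *-assoc 2 x s ⟨
    2 * x * s                                   ≡⟨ *-distribˡ-sum (2 * x) (c ∘ suc) ⟩
    sum (λ i → 2 * x * c (suc i))
      ≤⟨ sum-mono (λ i → ≤-trans (≤-reflexive (*-assoc 2 x (c (suc i)))) (2xy≤x²+y² x (c (suc i)))) ⟩
    sum (λ i → x * x + c (suc i) * c (suc i))   ≡⟨ ∑-distrib-+ {n} (λ _ → x * x) (λ i → c (suc i) * c (suc i)) ⟩
    sum {n} (λ _ → x * x) + q                   ≡⟨ cong (_+ q) (sum-const n (x * x)) ⟩
    n * (x * x) + q                             ∎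

δ : Fin n → Fin n → ℕ
δ i j = if does (i Fin.≟ j) then 1 else 0

sum-δ : (i : Fin n) (g : Fin n → ℕ) → sum (λ j → δ i j * g j) ≡ g i
sum-δ {suc n} zero    g = trans (cong₂ _+_ (+-identityʳ (g zero)) (sum-replicate-zero n)) (+-identityʳ _)
sum-δ {suc n} (suc i) g = sum-δ i (g ∘ suc)

length-as-sum : (xs : List A) → length xs ≡ sumᴸ (map (λ _ → 1) xs)
length-as-sum []       = refl
length-as-sum (x ∷ xs) = cong suc (length-as-sum xs)

module _ (f : A → Fin n) where

  fibre : List A → Fin n → ℕ
  fibre xs i = length (filter (λ x → f x Fin.≟ i) xs)

  -- Ordered pairs with the diagonal included, so that their number is exactly the sum of the
  -- squared fibre sizes.
  collisions : List A → List (A × A)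
  collisions xs = filter (λ xy → f (proj₂ xy) Fin.≟ f (proj₁ xy)) (cartesianProduct xs xs)

  fibre-∷ : ∀ x xs i → fibre (x ∷ xs) i ≡ δ (f x) i + fibre xs i
  fibre-∷ x xs i with does (f x Fin.≟ i)
  ... | true  = refl
  ... | false = refl

  -- Double counting by the value of `f`: applied with `g` constantly 1 for the length, and with `g`
  -- the fibre size for the collisions.
  sum-fibre : ∀ (g : Fin n → ℕ) xs → sumᴸ (map (g ∘ f) xs) ≡ sum (λ i → fibre xs i * g i)
  sum-fibre g []       = sym (sum-replicate-zero n)
  sum-fibre g (x ∷ xs) = begin
    g (f x) + sumᴸ (map (g ∘ f) xs)                        ≡⟨ cong₂ _+_ (sym (sum-δ (f x) g)) (sum-fibre g xs) ⟩
    sum (λ i → δ (f x) i * g i) + sum (λ i → fibre xs i * g i)  ≡⟨ ∑-distrib-+ (λ i → δ (f x) i * g i) _ ⟨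
    sum (λ i → δ (f x) i * g i + fibre xs i * g i)
      ≡⟨ sum-cong-≗ (λ i → trans (sym (*-distribʳ-+ (g i) (δ (f x) i) _)) (cong (_* g i) (sym (fibre-∷ x xs i)))) ⟩
    sum (λ i → fibre (x ∷ xs) i * g i)                          ∎
    where open ≡-Reasoning

  length-filter-row : ∀ x ys → length (filter (λ xy → f (proj₂ xy) Fin.≟ f (proj₁ xy)) (map (x ,_) ys)) ≡ fibre ys (f x)
  length-filter-row x []       = refl
  length-filter-row x (y ∷ ys) with does (f y Fin.≟ f x)
  ... | true  = cong suc (length-filter-row x ys)
  ... | false = length-filter-row x ys

  length-filter-rows : ∀ xs ys → length (filter (λ xy → f (proj₂ xy) Fin.≟ f (proj₁ xy)) (cartesianProduct xs ys))
                      ≡ sumᴸ (map (fibre ys ∘ f) xs)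
  length-filter-rows []       ys = refl
  length-filter-rows (x ∷ xs) ys = begin
    length (filter Q? (map (x ,_) ys ++ cartesianProduct xs ys))
      ≡⟨ cong length (filter-++ Q? (map (x ,_) ys) _) ⟩
    length (filter Q? (map (x ,_) ys) ++ filter Q? (cartesianProduct xs ys))
      ≡⟨ length-++ (filter Q? (map (x ,_) ys)) ⟩
    _ ≡⟨ cong₂ _+_ (length-filter-row x ys) (length-filter-rows xs ys) ⟩
    sumᴸ (map (fibre ys ∘ f) (x ∷ xs)) ∎
    where
    open ≡-Reasoning
    Q? = λ xy → f (proj₂ xy) Fin.≟ f (proj₁ xy)

  length²≤collisions : ∀ xs → length xs * length xs ≤ n * length (collisions xs)
  length²≤collisions xs = begin
    length xs * length xs                      ≡⟨ cong₂ _*_ length≡ length≡ ⟩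
    sum (fibre xs) * sum (fibre xs)            ≤⟨ sum²≤ (fibre xs) ⟩
    n * sum (λ i → fibre xs i * fibre xs i)
      ≡⟨ cong (n *_) (trans (length-filter-rows xs xs) (sum-fibre (fibre xs) xs)) ⟨
    n * length (collisions xs)                 ∎
    where
    open ≤-Reasoning
    length≡ : length xs ≡ sum (fibre xs)
    length≡ = trans (length-as-sum xs) (trans (sum-fibre (λ _ → 1) xs) (sum-cong-≗ (λ i → *-identityʳ (fibre xs i))))

-- Paths and geodesics

Adjacency : ℕ → Set
Adjacency n = Fin n → Fin n → Bool

private variable
  R R′ : Adjacency n

data Path {n} (R : Adjacency n) : ℕ → Fin n → Fin n → Set where
  nil  : Path R 0 u u
  cons : R u w ≡ true → Path R k w v → Path R (suc k) u v

_◅◅_ : Path R j u w → Path R k w v → Path R (j + k) u v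
nil      ◅◅ Q = Q
cons r P ◅◅ Q = cons r (P ◅◅ Q)

-- Positions past the end return the last vertex, so no bound on the index is carried.
vertexAt : {R : Adjacency n} → Path R k u v → ℕ → Fin n
vertexAt {u = u} nil        i       = u
vertexAt {u = u} (cons _ P) zero    = u
vertexAt         (cons _ P) (suc i) = vertexAt P i

vertexAt-0 : (P : Path R k u v) → vertexAt P 0 ≡ u
vertexAt-0 nil        = refl
vertexAt-0 (cons _ _) = refl

vertexAt-k : (P : Path R k u v) → vertexAt P k ≡ v
vertexAt-k nil        = refl
vertexAt-k (cons _ P) = vertexAt-k P

segment : (P : Path R k u v) → ∀ {i j} → i ≤ j → j ≤ k → Path R (j ∸ i) (vertexAt P i) (vertexAt P j)
segment P          {zero}  {zero}  _         _         = nil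
segment {R = R} (cons r P) {zero}  {suc j} _ (s≤s j≤k) =
  cons r (subst (λ x → Path R j x (vertexAt P j)) (vertexAt-0 P) (segment P z≤n j≤k))
segment (cons r P) {suc i} {suc j} (s≤s i≤j) (s≤s j≤k) = segment P i≤j j≤k

edgeAt : (P : Path R k u v) → ∀ {i} → i < k → R (vertexAt P i) (vertexAt P (suc i)) ≡ true
edgeAt {R = R} (cons r P) {zero}  _         = subst (λ x → R _ x ≡ true) (sym (vertexAt-0 P)) r
edgeAt         (cons r P) {suc i} (s≤s i<k) = edgeAt P i<k

record Geodesic {n} (R : Adjacency n) : Set where
  field
    {source target} : Fin n
    {len}    : ℕ
    path     : Path R len source target
    shortest : Path R k source target → len ≤ k

  vertex : ℕ → Fin n
  vertex = vertexAt path

  toTarget : ∀ {i} → i ≤ len → Path R (len ∸ i) (vertex i) target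
  toTarget {i} i≤len = subst (Path R (len ∸ i) (vertex i)) (vertexAt-k path) (segment path i≤len ≤-refl)

  fromSource : ∀ {i} → i ≤ len → Path R i source (vertex i)
  fromSource {i} i≤len = subst (λ x → Path R i x (vertex i)) (vertexAt-0 path) (segment path z≤n i≤len)

  -- Splicing `P` in place of the segment gives a path from `source` to `target`, to which
  -- `shortest` applies.
  segment-shortest : ∀ {i j} → i ≤ j → j ≤ len → Path R k (vertex i) (vertex j) → j ∸ i ≤ k
  segment-shortest {k} {i} {j} i≤j j≤len P = +-cancelˡ-≤ i (j ∸ i) k (+-cancelʳ-≤ (len ∸ j) _ _ (begin
    i + (j ∸ i) + (len ∸ j)  ≡⟨ cong (_+ (len ∸ j)) (m+[n∸m]≡n i≤j) ⟩
    j + (len ∸ j)            ≡⟨ m+[n∸m]≡n j≤len ⟩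
    len                      ≤⟨ shortest ((fromSource (≤-trans i≤j j≤len) ◅◅ P) ◅◅ toTarget j≤len) ⟩
    i + k + (len ∸ j)        ∎))
    where open ≤-Reasoning

-- What edge-minimality yields, separated from the pruning: every edge is a step of one chosen
-- geodesic and is oriented along it, and by `forced` no other step from its tail leads to the
-- target in the number of steps that remain.
record CriticalEdges {n} (R : Adjacency n) (p m : ℕ) : Set where
  open Geodesic

  field
    route : Fin p → Geodesic R
    owner : Fin m → Fin p
    pos   : Fin m → ℕ
    pos<  : ∀ e → pos e < len (route (owner e))

  tail : Fin m → Fin n
  tail e = vertex (route (owner e)) (pos e)

  head : Fin m → Fin n
  head e = vertex (route (owner e)) (suc (pos e))

  field
    distinct : ∀ {e f} → tail e ≡ tail f → head e ≡ head f → e ≡ f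
    forced   : ∀ e {z} → R (tail e) z ≡ true →
               Path R (len (route (owner e)) ∸ suc (pos e)) z (target (route (owner e))) → z ≡ head e

  -- The distance from `tail e` to `head f` along their common route, both edges counted; meaningful
  -- under `Before e f`.
  span : Fin m → Fin m → ℕ
  span e f = suc (pos f) ∸ pos e

  -- Reflexive, so that any two edges with the same owner, equal or not, are comparable.
  Before : Fin m → Fin m → Set
  Before e f = owner e ≡ owner f × pos e ≤ pos f

  Before? : Decidable (λ (ef : Fin m × Fin m) → Before (proj₁ ef) (proj₂ ef))
  Before? (e , f) = (owner e Fin.≟ owner f) ×-dec (pos e ≤? pos f)

  edge : ∀ e → R (tail e) (head e) ≡ true
  edge e = edgeAt (path (route (owner e))) (pos< e)

  pos+span : ∀ {e f} → Before e f → pos e + span e f ≡ suc (pos f)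
  pos+span (_ , e≤f) = m+[n∸m]≡n (m≤n⇒m≤1+n e≤f)

  -- The owners are generalised to `q` and `r` so that their equation can be matched with `refl`.
  route-segment : ∀ {q r} → q ≡ r → ∀ {i j} → i ≤ j → j ≤ len (route r) →
                  Path R (j ∸ i) (vertex (route q) i) (vertex (route r) j)
  route-segment refl = segment (path (route _))

  tail⇝head : ∀ {e f} → Before e f → Path R (span e f) (tail e) (head f)
  tail⇝head {e} {f} (o , e≤f) = route-segment o (m≤n⇒m≤1+n e≤f) (pos< f)

  head⇝head : ∀ {e f} → Before e f → Path R (pos f ∸ pos e) (head e) (head f)
  head⇝head {e} {f} (o , e≤f) = route-segment o (s≤s e≤f) (pos< f)

  head⇝tail : ∀ {e f} → owner e ≡ owner f → pos e < pos f → Path R (pos f ∸ suc (pos e)) (head e) (tail f)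
  head⇝tail {e} {f} o e<f = route-segment o e<f (<⇒≤ (pos< f))

  span-shortest : ∀ {e f} → Before e f → Path R k (tail e) (head f) → span e f ≤ k
  span-shortest {e = e} {f} (o , e≤f) = aux o (m≤n⇒m≤1+n e≤f) (pos< f)
    where
    aux : ∀ {q r} → q ≡ r → ∀ {i j} → i ≤ j → j ≤ len (route r) →
          Path R k (vertex (route q) i) (vertex (route r) j) → j ∸ i ≤ k
    aux refl = segment-shortest (route _)

  same-position : ∀ {e f} → owner e ≡ owner f → pos e ≡ pos f → e ≡ f
  same-position o i = distinct (cong₂ (λ q j → vertex (route q) j) o i)
                               (cong₂ (λ q j → vertex (route q) (suc j)) o i)

  -- `P` followed by the route from `head f` onwards reaches the target in exactly the number of
  -- steps left after `e`, so `forced` applies to `z`.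
  detour : ∀ {e f z} → Before e f → R (tail e) z ≡ true → Path R k z (head f) → suc k ≡ span e f →
           z ≡ head e
  detour {k} {e} {f} {z} b@(o , e≤f) r P eq =
    forced e r (subst₂ (λ i t → Path R i z t) length≡ target≡ (P ◅◅ toTarget (route (owner f)) (pos< f)))
    where
    open ≡-Reasoning
    L = len (route (owner e))
    target≡ : target (route (owner f)) ≡ target (route (owner e))
    target≡ = cong (target ∘ route) (sym o)
    L≡ : len (route (owner f)) ≡ L
    L≡ = cong (len ∘ route) (sym o)
    reach : suc (pos e) + k ≡ suc (pos f)
    reach = trans (sym (+-suc (pos e) k)) (trans (cong (pos e +_) eq) (pos+span b))
    length≡ : k + (len (route (owner f)) ∸ suc (pos f)) ≡ L ∸ suc (pos e)
    length≡ = +-cancelˡ-≡ (suc (pos e)) _ _ (begin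
      suc (pos e) + (k + (len (route (owner f)) ∸ suc (pos f)))  ≡⟨ +-assoc (suc (pos e)) k _ ⟨
      suc (pos e) + k + (len (route (owner f)) ∸ suc (pos f))
        ≡⟨ cong (_+ (len (route (owner f)) ∸ suc (pos f))) reach ⟩
      suc (pos f) + (len (route (owner f)) ∸ suc (pos f))        ≡⟨ m+[n∸m]≡n (pos< f) ⟩
      len (route (owner f))                                      ≡⟨ L≡ ⟩
      L                                                          ≡⟨ m+[n∸m]≡n (pos< e) ⟨
      suc (pos e) + (L ∸ suc (pos e))                            ∎)

  -- Follow `e`, continue on its route to `tail g`, then take the route of `g′` to `head h′`. The
  -- last hypothesis says that this is as short as the segment from `tail e′` to `head f′`, so
  -- `detour` for `e′` identifies the first steps.
  no-shortcut : ∀ {e e′ f′ g g′ h′} →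
    owner e ≡ owner g → pos e < pos g →
    tail e ≡ tail e′ → Before e′ f′ → tail g ≡ tail g′ → Before g′ h′ → head f′ ≡ head h′ →
    pos e + span e′ f′ ≡ pos g + span g′ h′ → e ≡ e′
  no-shortcut {e} {e′} {f′} {g} {g′} {h′} o e<g te b tg b′ hh level =
    distinct te (detour b (subst (λ x → R x (head e) ≡ true) te (edge e)) P len≡)
    where
    P : Path R (pos g ∸ suc (pos e) + span g′ h′) (head e) (head f′)
    P = head⇝tail o e<g ◅◅ subst₂ (Path R (span g′ h′)) (sym tg) (sym hh) (tail⇝head b′)
    open ≡-Reasoning
    len≡ : suc (pos g ∸ suc (pos e) + span g′ h′) ≡ span e′ f′
    len≡ = +-cancelˡ-≡ (pos e) _ _ (begin
      pos e + suc (pos g ∸ suc (pos e) + span g′ h′)   ≡⟨ +-suc (pos e) _ ⟩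
      suc (pos e) + (pos g ∸ suc (pos e) + span g′ h′) ≡⟨ +-assoc (suc (pos e)) _ _ ⟨
      suc (pos e) + (pos g ∸ suc (pos e)) + span g′ h′ ≡⟨ cong (_+ span g′ h′) (m+[n∸m]≡n e<g) ⟩
      pos g + span g′ h′                               ≡⟨ level ⟨
      pos e + span e′ f′                               ∎)

  -- The segment from `g` to `h` is a second shortest way from `tail e` to `head f`, so `detour`
  -- makes it start with `e`; equal spans then put `f` and `h` at the same position of one route.
  no-fork : ∀ {e f g h} → tail e ≡ tail g → Before e f → Before g h → head f ≡ head h →
            span e f ≡ span g h → e ≡ g × f ≡ h
  no-fork {e} {f} {g} {h} te b b′@(o′ , g≤h) hh eq with distinct te (sym head≡)
    where
    head≡ : head g ≡ head e
    head≡ = detour b (subst (λ x → R x (head g) ≡ true) (sym te) (edge g))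
                   (subst (Path R _ (head g)) (sym hh) (head⇝head b′))
                   (trans (sym (+-∸-assoc 1 g≤h)) (sym eq))
  ... | refl = refl , same-position (trans (sym (proj₁ b)) o′)
                        (suc-injective (trans (sym (pos+span b)) (trans (cong (pos e +_) eq) (pos+span b′))))

-- Clusters and crossings

-- Injectivity on index pairs says at once that a cluster has `D` distinct vertices and that
-- clusters are disjoint. The common neighbour is kept only through `close`; for `j ≡ j′` the path
-- goes to it and back.
record Clusters {n} (R : Adjacency n) (D N : ℕ) : Set where
  field
    member    : Fin N → Fin D → Fin n
    injective : ∀ {i j i′ j′} → member i j ≡ member i′ j′ → i ≡ i′ × j ≡ j′
    close     : ∀ i j j′ → Path R 2 (member i j) (member i j′)

  size : N * D ≤ n
  size = Fin.injective⇒≤ {f = f} λ {x} {y} eq → begin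
    x                            ≡⟨ Fin.combine-remQuot {N} D x ⟨
    uncurry combine (slots x)    ≡⟨ cong₂ combine (proj₁ (injective eq)) (proj₂ (injective eq)) ⟩
    uncurry combine (slots y)    ≡⟨ Fin.combine-remQuot {N} D y ⟩
    y                            ∎
    where
    open ≡-Reasoning
    slots : Fin (N * D) → Fin N × Fin D
    slots = remQuot {N} D
    f : Fin (N * D) → Fin n
    f x = member (proj₁ (slots x)) (proj₂ (slots x))

-- Counting ordered pairs and their crossings

index-inj : {A : Set} {xs : List A} {x y : A} (p : x ∈ xs) (q : y ∈ xs) → index p ≡ index q → x ≡ y
index-inj = index-injective (setoid _)

module Count {n p m N D} {R : Adjacency n} (E : CriticalEdges R p m) (C : Clusters R D N)
  (cluster : Fin m → Fin N) (slot : Fin m → Fin D)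
  (head≡ : ∀ e → CriticalEdges.head E e ≡ Clusters.member C (cluster e) (slot e)) where

  open CriticalEdges E
  open Clusters C

  Edge² = Fin m × Fin m

  edges² : List Edge²
  edges² = cartesianProduct (allFin m) (allFin m)

  edges²! : Unique edges²
  edges²! = cartesianProduct⁺ (allFin⁺ m) (allFin⁺ m)

  ordered : List Edge²
  ordered = filter Before? edges²

  ordered! : Unique ordered
  ordered! = filter⁺ Before? edges²!

  ∈-ordered⁺ : ∀ {e f} → Before e f → (e , f) ∈ ordered
  ∈-ordered⁺ {e} {f} b = ∈-filter⁺ Before? (∈-cartesianProduct⁺ (∈-allFin e) (∈-allFin f)) b

  ∈-ordered⁻ : ∀ {e f} → (e , f) ∈ ordered → Before e f
  ∈-ordered⁻ = proj₂ ∘ ∈-filter⁻ Before? {xs = edges²}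

  S : ℕ
  S = length ordered

  sameOwner : List Edge²
  sameOwner = collisions owner (allFin m)

  Owner? : Decidable (λ (ef : Edge²) → owner (proj₂ ef) ≡ owner (proj₁ ef))
  Owner? ef = owner (proj₂ ef) Fin.≟ owner (proj₁ ef)

  Pos? : Decidable (λ (ef : Edge²) → pos (proj₁ ef) ≤ pos (proj₂ ef))
  Pos? ef = pos (proj₁ ef) ≤? pos (proj₂ ef)

  -- A pair with a common owner is ordered as it stands or after swapping, and both maps into
  -- `ordered` are injective.
  sameOwner≤ : length sameOwner ≤ S + S
  sameOwner≤ = ≤-trans (≤-reflexive (length-filter-¬ Pos? sameOwner)) (+-mono-≤
    (Unique-length (filter⁺ Pos? uniq) (λ x → index ∘ fwd x) (λ x y → index-inj (fwd _ x) (fwd _ y)))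
    (Unique-length (filter⁺ (¬? ∘ Pos?) uniq) (λ x → index ∘ bwd x)
      (λ x y eq → swap-inj (index-inj (bwd _ x) (bwd _ y) eq))))
    where
    uniq = filter⁺ Owner? edges²!
    fwd : ∀ ef → ef ∈ filter Pos? sameOwner → ef ∈ ordered
    fwd ef x with ∈-filter⁻ Pos? {xs = sameOwner} x
    ... | s , le = ∈-ordered⁺ (sym (proj₂ (∈-filter⁻ Owner? {xs = edges²} s)) , le)
    bwd : ∀ ef → ef ∈ filter (¬? ∘ Pos?) sameOwner → (proj₂ ef , proj₁ ef) ∈ ordered
    bwd ef x with ∈-filter⁻ (¬? ∘ Pos?) {xs = sameOwner} x
    ... | s , nle = ∈-ordered⁺ (proj₂ (∈-filter⁻ Owner? {xs = edges²} s) , <⇒≤ (≰⇒> nle))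
    swap-inj : ∀ {x y : Edge²} → (proj₂ x , proj₁ x) ≡ (proj₂ y , proj₁ y) → x ≡ y
    swap-inj refl = refl

  m²≤ : m * m ≤ p * (S + S)
  m²≤ = begin
    m * m
      ≡⟨ cong₂ _*_ (length-tabulate {n = m} (λ i → i)) (length-tabulate {n = m} (λ i → i)) ⟨
    length (allFin m) * length (allFin m)    ≤⟨ length²≤collisions owner (allFin m) ⟩
    p * length sameOwner                     ≤⟨ *-monoʳ-≤ p sameOwner≤ ⟩
    p * (S + S)                              ∎
    where open ≤-Reasoning

  key : Edge² → Fin (n * N)
  key (e , f) = combine (tail e) (cluster f)

  Edge⁴ = Edge² × Edge²

  crossings : List Edge⁴
  crossings = collisions key ordered

  Key? : Decidable (λ (x : Edge⁴) → key (proj₂ x) ≡ key (proj₁ x))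
  Key? x = key (proj₂ x) Fin.≟ key (proj₁ x)

  crossings! : Unique crossings
  crossings! = filter⁺ Key? (cartesianProduct⁺ ordered! ordered!)

  record Crossing (e f e′ f′ : Fin m) : Set where
    constructor crossing
    field
      before   : Before e f
      before′  : Before e′ f′
      tail≡    : tail e ≡ tail e′
      cluster≡ : cluster f ≡ cluster f′

    nearby : Path R 2 (head f) (head f′)
    nearby = subst₂ (Path R 2) (sym (head≡ f))
               (sym (trans (head≡ f′) (cong (λ c → member c (slot f′)) (sym cluster≡))))
               (close (cluster f) (slot f) (slot f′))

    nearby′ : Path R 2 (head f′) (head f)
    nearby′ = subst₂ (Path R 2) (sym (head≡ f′))
                (sym (trans (head≡ f) (cong (λ c → member c (slot f)) cluster≡)))
                (close (cluster f′) (slot f′) (slot f))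

    -- From the common tail, the route of `e′` to `head f′` and two steps through the cluster
    -- compete with the geodesic to `head f`.
    span≤ : span e f ≤ span e′ f′ + 2
    span≤ = span-shortest before (subst (λ x → Path R _ x (head f)) (sym tail≡) (tail⇝head before′ ◅◅ nearby′))

    span′≤ : span e′ f′ ≤ span e f + 2
    span′≤ = span-shortest before′ (subst (λ x → Path R _ x (head f′)) tail≡ (tail⇝head before ◅◅ nearby))

    -- The spans differ by at most 2 either way; shifting by 2 keeps the difference in ℕ, with 5
    -- possible values.
    offset< : (span e′ f′ + 2) ∸ span e f < 5
    offset< = s≤s (begin
      (span e′ f′ + 2) ∸ span e f      ≤⟨ ∸-monoˡ-≤ (span e f) (+-monoˡ-≤ 2 span′≤) ⟩
      (span e f + 2 + 2) ∸ span e f    ≡⟨ cong (_∸ span e f) (+-assoc (span e f) 2 2) ⟩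
      (span e f + 4) ∸ span e f        ≡⟨ m+n∸m≡n (span e f) 4 ⟩
      4                                ∎)
      where open ≤-Reasoning

    offset : Fin 5
    offset = fromℕ< offset<

    span+offset : span e f + toℕ offset ≡ span e′ f′ + 2
    span+offset = trans (cong (span e f +_) (Fin.toℕ-fromℕ< offset<)) (m+[n∸m]≡n span≤)

  open Crossing

  ∈-crossings⁻ : ∀ {e f e′ f′} → ((e , f) , (e′ , f′)) ∈ crossings → Crossing e f e′ f′
  ∈-crossings⁻ {e} {f} {e′} {f′} x with ∈-filter⁻ Key? {xs = cartesianProduct ordered ordered} x
  ... | x∈ , eq with ∈-cartesianProduct⁻ ordered ordered x∈
                   | Fin.combine-injective (tail e′) (cluster f′) (tail e) (cluster f) eq
  ... | a , b | t , c = crossing (∈-ordered⁻ a) (∈-ordered⁻ b) (sym t) (sym c)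

  -- Both `pos e + span e f` and `pos g + span g f` equal `suc (pos f)`, and equal offsets carry
  -- this over to the second pairs.
  level : ∀ {e f e′ f′ g g′ h′} (x : Crossing e f e′ f′) (y : Crossing g f g′ h′) → offset x ≡ offset y →
          pos e + span e′ f′ ≡ pos g + span g′ h′
  level {e} {f} {e′} {f′} {g} {g′} {h′} x y eq = +-cancelʳ-≡ 2 _ _ (begin
    pos e + span e′ f′ + 2             ≡⟨ +-assoc (pos e) _ 2 ⟩
    pos e + (span e′ f′ + 2)           ≡⟨ cong (pos e +_) (span+offset x) ⟨
    pos e + (span e f + o x)           ≡⟨ +-assoc (pos e) _ _ ⟨
    pos e + span e f + o x
      ≡⟨ cong₂ _+_ (trans (pos+span (before x)) (sym (pos+span (before y)))) (cong toℕ eq) ⟩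
    pos g + span g f + o y             ≡⟨ +-assoc (pos g) _ _ ⟩
    pos g + (span g f + o y)           ≡⟨ cong (pos g +_) (span+offset y) ⟩
    pos g + (span g′ h′ + 2)           ≡⟨ +-assoc (pos g) _ 2 ⟨
    pos g + span g′ h′ + 2             ∎)
    where
    open ≡-Reasoning
    o : ∀ {e f e′ f′} → Crossing e f e′ f′ → ℕ
    o z = toℕ (offset z)

  -- Equal offsets make the walk from tail e along f's owner to tail g, then along the owner of g′ to head f′,
  -- as short as the geodesic of e′; so it must start with e′.
  crossing-unique : ∀ {e f e′ f′ g g′ h′} (x : Crossing e f e′ f′) (y : Crossing g f g′ h′) →
    e ≢ e′ → g ≢ g′ → head f′ ≡ head h′ → offset x ≡ offset y → e ≡ g × e′ ≡ g′ × f′ ≡ h′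
  crossing-unique {e} {f} {e′} {f′} {g} {g′} {h′} x y e≢e′ g≢g′ hh eq with <-cmp (pos e) (pos g)
  ... | tri< e<g _ _ = contradiction
          (no-shortcut (trans (proj₁ (before x)) (sym (proj₁ (before y)))) e<g
            (tail≡ x) (before′ x) (tail≡ y) (before′ y) hh (level x y eq)) e≢e′
  ... | tri> _ _ g<e = contradiction
          (no-shortcut (trans (proj₁ (before y)) (sym (proj₁ (before x)))) g<e
            (tail≡ y) (before′ y) (tail≡ x) (before′ x) (sym hh) (level y x (sym eq))) g≢g′
  ... | tri≈ _ e≈g _ with same-position (trans (proj₁ (before x)) (sym (proj₁ (before y)))) e≈g
  ... | refl = refl , no-fork (trans (sym (tail≡ x)) (tail≡ y)) (before′ x) (before′ y) hh
                        (+-cancelˡ-≡ (pos e) _ _ (level x y eq))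

  Same? : Decidable (λ (x : Edge⁴) → proj₁ (proj₁ x) ≡ proj₁ (proj₂ x))
  Same? ((e , _) , (e′ , _)) = e Fin.≟ e′

  -- When `e ≡ e′`, the pair `(e , f)` and the offset determine `f′`: its owner is that of `e`, and
  -- `level` gives its position.
  same≤ : length (filter Same? crossings) ≤ S * 5
  same≤ = Unique-length (filter⁺ Same? crossings!) (λ _ x → code (proj₁ (∈⁻ x))) (λ x y → code-inj (∈⁻ x) (∈⁻ y))
    where
    ∈⁻ : ∀ {e f e′ f′} → ((e , f) , (e′ , f′)) ∈ filter Same? crossings → Crossing e f e′ f′ × e ≡ e′
    ∈⁻ x with ∈-filter⁻ Same? {xs = crossings} x
    ... | c , eq = ∈-crossings⁻ c , eq
    code : ∀ {e f e′ f′} → Crossing e f e′ f′ → Fin (S * 5)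
    code x = combine (index (∈-ordered⁺ (before x))) (offset x)
    code-inj : ∀ {e f e′ f′ g h g′ h′} (x : Crossing e f e′ f′ × e ≡ e′) (y : Crossing g h g′ h′ × g ≡ g′) →
               code (proj₁ x) ≡ code (proj₁ y) → ((e , f) , (e′ , f′)) ≡ ((g , h) , (g′ , h′))
    code-inj (x , refl) (y , refl) eq
      with i≡ , o≡ ← Fin.combine-injective (index (∈-ordered⁺ (before x))) (offset x) (index (∈-ordered⁺ (before y))) (offset y) eq
      with refl ← index-inj (∈-ordered⁺ (before x)) (∈-ordered⁺ (before y)) i≡
      = cong (λ h → _ , (_ , h)) (same-position (trans (sym (proj₁ (before′ x))) (proj₁ (before′ y)))
          (suc-injective (trans (sym (pos+span (before′ x))) (trans (level x y o≡) (pos+span (before′ y))))))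

  -- As `f` and `f′` share a cluster, `f` and the slot of `f′` fix the vertex `head f′`; with the
  -- offset, `crossing-unique` recovers the other edges.
  different≤ : length (filter (¬? ∘ Same?) crossings) ≤ m * D * 5
  different≤ = Unique-length (filter⁺ (¬? ∘ Same?) crossings!) (λ _ x → code (proj₁ (∈⁻ x))) (λ x y → code-inj (∈⁻ x) (∈⁻ y))
    where
    ∈⁻ : ∀ {e f e′ f′} → ((e , f) , (e′ , f′)) ∈ filter (¬? ∘ Same?) crossings → Crossing e f e′ f′ × e ≢ e′
    ∈⁻ x with ∈-filter⁻ (¬? ∘ Same?) {xs = crossings} x
    ... | c , neq = ∈-crossings⁻ c , neq
    code : ∀ {e f e′ f′} → Crossing e f e′ f′ → Fin (m * D * 5)
    code {f = f} {f′ = f′} x = combine (combine f (slot f′)) (offset x)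
    code-inj : ∀ {e f e′ f′ g h g′ h′} (x : Crossing e f e′ f′ × e ≢ e′) (y : Crossing g h g′ h′ × g ≢ g′) →
               code (proj₁ x) ≡ code (proj₁ y) → ((e , f) , (e′ , f′)) ≡ ((g , h) , (g′ , h′))
    code-inj {f = f} {f′ = f′} {h = h} {h′ = h′} (x , e≢e′) (y , g≢g′) eq
      with fs≡ , o≡ ← Fin.combine-injective (combine f (slot f′)) (offset x) (combine h (slot h′)) (offset y) eq
      with refl , s≡ ← Fin.combine-injective f (slot f′) h (slot h′) fs≡
      with refl , refl , refl ← crossing-unique x y e≢e′ g≢g′
             (trans (head≡ f′) (trans (cong₂ member (trans (sym (cluster≡ x)) (cluster≡ y)) s≡) (sym (head≡ h′)))) o≡
      = refl

  S²≤ : D * (S * S) ≤ n * n * (S * 5 + m * D * 5)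
  S²≤ = begin
    D * (S * S)                       ≤⟨ *-monoʳ-≤ D (length²≤collisions key ordered) ⟩
    D * (n * N * length crossings)
      ≡⟨ solve 4 (λ D n N c → D :* (n :* N :* c) := n :* (N :* D) :* c) refl D n N (length crossings) ⟩
    -- Disjointness gives `N * D ≤ n`, so the factor `D` pays for the number of clusters.
    n * (N * D) * length crossings
      ≤⟨ *-mono-≤ (*-monoʳ-≤ n size) (≤-trans (≤-reflexive (length-filter-¬ Same? crossings)) (+-mono-≤ same≤ different≤)) ⟩
    n * n * (S * 5 + m * D * 5)       ∎
    where
    open ≤-Reasoning
    open +-*-Solver

-- Greedy clustering

Symmetric : ∀ {n} → Adjacency n → Set
Symmetric R = ∀ {u v} → R u v ≡ true → R v u ≡ true

module _ {n D N} {R : Adjacency n} (C : Clusters R D N) where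
  open Clusters C

  Clustered : Fin n → Set
  Clustered w = ∃[ i ] ∃[ j ] member i j ≡ w

  Clustered? : Decidable Clustered
  Clustered? w = Fin.any? λ i → Fin.any? λ j → member i j Fin.≟ w

  BothClustered : Fin n × Fin n → Set
  BothClustered (a , b) = Clustered a × Clustered b

  BothClustered? : Decidable BothClustered
  BothClustered? (a , b) = Clustered? a ×-dec Clustered? b

  Free : Fin n → Fin n → Set
  Free c w = R c w ≡ true × ¬ Clustered w

  Free? : ∀ c → Decidable (Free c)
  Free? c w = (R c w Bool.≟ true) ×-dec ¬? (Clustered? w)

  freeNeighbours : Fin n → List (Fin n)
  freeNeighbours c = filter (Free? c) (allFin n)

  ∈-freeNeighbours⁻ : ∀ {c w} → w ∈ freeNeighbours c → Free c w
  ∈-freeNeighbours⁻ {c} = proj₂ ∘ ∈-filter⁻ (Free? c) {xs = allFin n}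

  ∈-freeNeighbours⁺ : ∀ {c w} → Free c w → w ∈ freeNeighbours c
  ∈-freeNeighbours⁺ {c} {w} = ∈-filter⁺ (Free? c) (∈-allFin w)

  module _ (R-sym : Symmetric R) (c : Fin n) (D≤ : D ≤ length (freeNeighbours c)) where

    new : Fin D → Fin n
    new j = lookup (freeNeighbours c) (inject≤ j D≤)

    new-free : ∀ j → Free c (new j)
    new-free j = ∈-freeNeighbours⁻ (∈-lookup (inject≤ j D≤))

    -- The new members are unclustered, hence disjoint from the old clusters, and `c` is the middle
    -- of their paths of length 2.
    addCluster : Clusters R D (suc N)
    addCluster = record { member = member′ ; injective = λ {i} {j} {i′} {j′} → injective′ {i} {j} {i′} {j′} ; close = close′ }
      where
      member′ : Fin (suc N) → Fin D → Fin n
      member′ zero    = new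
      member′ (suc i) = member i
      injective′ : ∀ {i j i′ j′} → member′ i j ≡ member′ i′ j′ → i ≡ i′ × j ≡ j′
      injective′ {zero}  {j} {zero}   {j′} eq =
        refl , Fin.inject≤-injective D≤ D≤ j j′ (Unique-lookup (filter⁺ (Free? c) (allFin⁺ n)) _ _ eq)
      injective′ {zero}  {j} {suc i′} {j′} eq = contradiction (i′ , j′ , sym eq) (proj₂ (new-free j))
      injective′ {suc i} {j} {zero}   {j′} eq = contradiction (i , j , eq) (proj₂ (new-free j′))
      injective′ {suc i} {j} {suc i′} {j′} eq with refl , refl ← injective eq = refl , refl
      close′ : ∀ i j j′ → Path R 2 (member′ i j) (member′ i j′)
      close′ zero    j j′ = cons (R-sym (proj₁ (new-free j))) (cons (proj₁ (new-free j′)) nil)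
      close′ (suc i) j j′ = close i j j′

-- Clusters are added while some vertex has `D` free neighbours. The fuel `suc n` suffices: using it
-- all up would give more than `n` disjoint nonempty clusters.
maximalClusters : ∀ {n} {R : Adjacency n} → Symmetric R → ∀ D .{{_ : NonZero D}} →
  ∃[ N ] Σ (Clusters R D N) λ C → ∀ c → length (freeNeighbours C c) < D
maximalClusters {n} {R} R-sym D = grow (suc n) {0} refl
  (record { member = λ () ; injective = λ { {()} } ; close = λ () })
  where
  grow : ∀ fuel {N} → N + fuel ≡ suc n → Clusters R D N →
         ∃[ N ] Σ (Clusters R D N) λ C → ∀ c → length (freeNeighbours C c) < D
  grow zero {N} eq C = contradiction (≤-trans (m≤m*n N D) (Clusters.size C))
                                     (<⇒≱ (≤-reflexive (trans (sym eq) (+-identityʳ N))))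
  grow (suc fuel) {N} eq C with Fin.any? (λ c → D ≤? length (freeNeighbours C c))
  ... | yes (c , D≤) = grow fuel (trans (sym (+-suc N fuel)) eq) (addCluster C R-sym c D≤)
  ... | no  none     = N , C , λ c → ≰⇒> λ D≤ → none (c , D≤)

module _ {n D N} {R : Adjacency n} (C : Clusters R D N) (sparse : ∀ c → length (freeNeighbours C c) < D) where

  freeIndex : ∀ {c w} → Free C c w → Fin D
  freeIndex {c} free = inject≤ (index (∈-freeNeighbours⁺ C free)) (<⇒≤ (sparse c))

  freeIndex-inj : ∀ {c v w} (x : Free C c v) (y : Free C c w) → freeIndex x ≡ freeIndex y → v ≡ w
  freeIndex-inj {c} x y eq = index-inj (∈-freeNeighbours⁺ C x) (∈-freeNeighbours⁺ C y)
    (Fin.inject≤-injective (<⇒≤ (sparse c)) (<⇒≤ (sparse c)) _ _ eq)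

  -- An edge is coded by one end and the place of the other, unclustered end among its free
  -- neighbours. The normalisation `a < b` prevents two entries from being reversals of each other.
  freeEdges≤ : Symmetric R → ∀ {es} → Unique es →
    (∀ {a b} → (a , b) ∈ es → a Data.Fin.< b × R a b ≡ true × ¬ BothClustered C (a , b)) → length es ≤ n * D
  freeEdges≤ R-sym {es} es! h = Unique-length es! (λ _ x → code (end x))
    (λ x y → code-inj (proj₁ (h x)) (proj₁ (h y)) (end x) (end y))
    where
    end : ∀ {a b} → (a , b) ∈ es → Free C b a ⊎ Free C a b
    end {a} {b} x with h x | Clustered? C a
    ... | _ , r , ¬both | no ¬a = inj₁ (R-sym r , ¬a)
    ... | _ , r , ¬both | yes a∈ = inj₂ (r , λ b∈ → ¬both (a∈ , b∈))
    code : ∀ {a b} → Free C b a ⊎ Free C a b → Fin (n * D)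
    code {b = b} (inj₁ x) = combine b (freeIndex x)
    code {a = a} (inj₂ x) = combine a (freeIndex x)
    code-inj : ∀ {a b a′ b′} → a Data.Fin.< b → a′ Data.Fin.< b′ →
               (x : Free C b a ⊎ Free C a b) (y : Free C b′ a′ ⊎ Free C a′ b′) →
               code x ≡ code y → (a , b) ≡ (a′ , b′)
    code-inj {b = b} {b′ = b′} _ _ (inj₁ x) (inj₁ y) eq
      with refl , i≡ ← Fin.combine-injective b (freeIndex x) b′ (freeIndex y) eq
      with refl ← freeIndex-inj x y i≡ = refl
    code-inj {a = a} {a′ = a′} _ _ (inj₂ x) (inj₂ y) eq
      with refl , i≡ ← Fin.combine-injective a (freeIndex x) a′ (freeIndex y) eq
      with refl ← freeIndex-inj x y i≡ = refl
    code-inj {b = b} {a′ = a′} a<b a′<b′ (inj₁ x) (inj₂ y) eq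
      with refl , i≡ ← Fin.combine-injective b (freeIndex x) a′ (freeIndex y) eq
      with refl ← freeIndex-inj x y i≡ = contradiction a′<b′ (<-asym a<b)
    code-inj {a = a} {b′ = b′} a<b a′<b′ (inj₂ x) (inj₁ y) eq
      with refl , i≡ ← Fin.combine-injective a (freeIndex x) b′ (freeIndex y) eq
      with refl ← freeIndex-inj x y i≡ = contradiction a′<b′ (<-asym a<b)

ordered-pairs : ∀ {n p m N D} {R : Adjacency n} (E : CriticalEdges R p m) (C : Clusters R D N) →
  (∀ e → Clustered C (CriticalEdges.head E e)) →
  ∃[ S ] m * m ≤ p * (S + S) × D * (S * S) ≤ n * n * (S * 5 + m * D * 5)
ordered-pairs E C clustered = S , m²≤ , S²≤
  where
  open Count E C (proj₁ ∘ clustered) (proj₁ ∘ proj₂ ∘ clustered) (sym ∘ proj₂ ∘ proj₂ ∘ clustered)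

-- Edge-minimal preservers

_⊆ᴬ_ : Adjacency n → Adjacency n → Set
R ⊆ᴬ R′ = ∀ {u v} → R u v ≡ true → R′ u v ≡ true

Path-mono : R ⊆ᴬ R′ → Path R k u v → Path R′ k u v
Path-mono R⊆ nil        = nil
Path-mono R⊆ (cons r P) = cons (R⊆ r) (Path-mono R⊆ P)

-- Decidability of distances

path? : (R : Adjacency n) → ∀ k u v → Dec (Path R k u v)
path? R zero u v = map′ (λ { refl → nil }) (λ { nil → refl }) (u Fin.≟ v)
path? R (suc k) u v = map′ (λ { (_ , r , P) → cons r P }) (λ { (cons r P) → _ , r , P })
  (Fin.any? λ w → (R u w Bool.≟ true) ×-dec path? R k w v)

IsDistance : Adjacency n → Fin n → Fin n → ℕ → Set
IsDistance R u v k = Path R k u v × (∀ {j} → Path R j u v → k ≤ j)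

distance-unique : IsDistance R u v j → IsDistance R u v k → j ≡ k
distance-unique (P , P-min) (Q , Q-min) = ≤-antisym (P-min Q) (Q-min P)

-- A path longer than `n` repeats a vertex by the pigeonhole principle; the loop is cut out and the
-- argument repeated.
shorten : ∀ {n k} {R : Adjacency n} {u v} → Path R k u v → ∃[ j ] j ≤ n × Path R j u v
shorten {n} {k} {R} {u} {v} = <-rec (λ k → Path R k u v → ∃[ j ] j ≤ n × Path R j u v) step k
  where
  step : ∀ k → (∀ {i} → i < k → Path R i u v → ∃[ j ] j ≤ n × Path R j u v) → Path R k u v → ∃[ j ] j ≤ n × Path R j u v
  step k rec P with k ≤? n
  ... | yes k≤n = k , k≤n , P
  ... | no  k≰n with Fin.pigeonhole (m≤n⇒m≤1+n (≰⇒> k≰n)) (λ (i : Fin (suc k)) → vertexAt P (toℕ i))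
  ... | i , j , i<j , eq = rec shorter (subst₂ (Path R (toℕ i)) (vertexAt-0 P) eq (segment P z≤n (≤-trans (<⇒≤ i<j) j≤k))
                                        ◅◅ subst (Path R (k ∸ toℕ j) (vertexAt P (toℕ j))) (vertexAt-k P) (segment P j≤k ≤-refl))
    where
    j≤k : toℕ j ≤ k
    j≤k = ≤-pred (Fin.toℕ<n j)
    shorter : toℕ i + (k ∸ toℕ j) < k
    shorter = <-≤-trans (+-monoˡ-< (k ∸ toℕ j) i<j) (≤-reflexive (m+[n∸m]≡n j≤k))

-- Lengths are tried from 0 upwards, so the first path found is shortest.
distance≤? : (R : Adjacency n) → ∀ u v b → ∃ (IsDistance R u v) ⊎ (∀ {j} → j ≤ b → ¬ Path R j u v)
distance≤? R u v zero with path? R 0 u v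
... | yes P = inj₁ (0 , P , λ _ → z≤n)
... | no ¬P = inj₂ λ { z≤n → ¬P }
distance≤? R u v (suc b) with distance≤? R u v b
... | inj₁ d = inj₁ d
... | inj₂ none with path? R (suc b) u v
... | yes P = inj₁ (suc b , P , λ Q → ≰⇒> λ j≤b → none j≤b Q)
... | no ¬P = inj₂ λ {j} j≤1+b Q → case-≤ (m≤n⇒m<n∨m≡n j≤1+b) Q
  where
  case-≤ : ∀ {j} → j < suc b ⊎ j ≡ suc b → ¬ Path R j u v
  case-≤ (inj₁ j<) = none (≤-pred j<)
  case-≤ (inj₂ refl) = ¬P

distance? : (R : Adjacency n) → ∀ u v → Dec (∃ (IsDistance R u v))
distance? {n} R u v with distance≤? R u v n
... | inj₁ d = yes d
... | inj₂ none = no λ (k , P , _) → let j , j≤n , Q = shorten P in none j≤n Q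

-- Deleting an undirected edge

SameEdge : Fin n → Fin n → Fin n → Fin n → Set
SameEdge a b u v = (u ≡ a × v ≡ b) ⊎ (u ≡ b × v ≡ a)

sameEdge? : (a b u v : Fin n) → Dec (SameEdge a b u v)
sameEdge? a b u v = ((u Fin.≟ a) ×-dec (v Fin.≟ b)) ⊎-dec ((u Fin.≟ b) ×-dec (v Fin.≟ a))

delete : Fin n → Fin n → Adjacency n → Adjacency n
delete a b R u v = R u v ∧ not (does (sameEdge? a b u v))

module _ (R : Adjacency n) (a b : Fin n) where

  delete-⊆ : delete a b R ⊆ᴬ R
  delete-⊆ {u} {v} eq with R u v
  ... | true = refl

  delete⁺ : R u v ≡ true → ¬ SameEdge a b u v → delete a b R u v ≡ true
  delete⁺ r ¬same = cong₂ _∧_ r (cong not (dec-false (sameEdge? a b _ _) ¬same))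

  delete⁻ : delete a b R u v ≡ true → ¬ SameEdge a b u v
  delete⁻ {u} {v} eq same
    with () ← trans (sym eq) (trans (cong (λ d → R u v ∧ not d) (dec-true (sameEdge? a b u v) same)) (Bool.∧-zeroʳ (R u v)))

  delete-sym : Symmetric R → Symmetric (delete a b R)
  delete-sym R-sym {u} {v} eq = delete⁺ {v} {u} (R-sym (delete-⊆ {u} {v} eq)) (delete⁻ {u} {v} eq ∘ swapped)
    where
    swapped : SameEdge a b v u → SameEdge a b u v
    swapped (inj₁ (p , q)) = inj₂ (q , p)
    swapped (inj₂ (p , q)) = inj₁ (q , p)

delete-mono : ∀ {a b} → R ⊆ᴬ R′ → delete a b R ⊆ᴬ delete a b R′
delete-mono {R = R} {R′ = R′} {a} {b} R⊆ {u} {v} eq =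
  delete⁺ R′ a b {u} {v} (R⊆ (delete-⊆ R a b {u} {v} eq)) (delete⁻ R a b {u} {v} eq)

-- Here `x` is an end of the deleted edge: a path either splits at `x` or never visits it and so
-- survives the deletion.
through : ∀ x → x ≡ a ⊎ x ≡ b → Path R k u v →
          (∃[ i ] ∃[ j ] i + j ≡ k × Path R i u x × Path R j x v) ⊎ Path (delete a b R) k u v
through {u = u} x x∈ P with u Fin.≟ x
through x x∈ P | yes refl = inj₁ (0 , _ , refl , nil , P)
through x x∈ nil | no _ = inj₂ nil
through {a = a} {b = b} {R = R} {u = u} x x∈ (cons {w = w} r P) | no u≢x with w Fin.≟ x | through x x∈ P
... | yes refl | _ = inj₁ (1 , _ , refl , cons r nil , P)
... | no _ | inj₁ (i , j , eq , Q , Q′) = inj₁ (suc i , j , cong suc eq , cons r Q , Q′)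
... | no w≢x | inj₂ Q = inj₂ (cons (delete⁺ R _ _ r (avoid x∈)) Q)
  where
  avoid : x ≡ a ⊎ x ≡ b → ¬ SameEdge a b u w
  avoid (inj₁ refl) (inj₁ (u≡ , _)) = u≢x u≡
  avoid (inj₁ refl) (inj₂ (_ , w≡)) = w≢x w≡
  avoid (inj₂ refl) (inj₁ (_ , w≡)) = w≢x w≡
  avoid (inj₂ refl) (inj₂ (u≡ , _)) = u≢x u≡

locate : ∀ a b (P : Path R k u v) →
         (∃[ i ] i < k × SameEdge a b (vertexAt P i) (vertexAt P (suc i))) ⊎ Path (delete a b R) k u v
locate a b nil = inj₂ nil
locate {R = R} a b (cons {u = u} {w = w} r P) with sameEdge? a b u w | locate a b P
... | yes same | _ = inj₁ (0 , z<s , subst (SameEdge a b u) (sym (vertexAt-0 P)) same)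
... | no _ | inj₁ (i , i<k , same) = inj₁ (suc i , s<s i<k , same)
... | no ¬same | inj₂ Q = inj₂ (cons (delete⁺ R _ _ r ¬same) Q)

module _ {n} {R : Adjacency n} {a b : Fin n} (γ : Geodesic R) where
  open Geodesic γ

  -- Suppose `z` is another vertex. If the initial part visits `vertex (suc i)`, or `Q` returns to
  -- `vertex i`, there is a shorter path from source to target. Otherwise the initial part, the step
  -- to `z` and `Q` form a path of length `len` that avoids the edge, against `lost`.
  forced-step : ¬ Path (delete a b R) len source target → ∀ {i z} → i < len →
                SameEdge a b (vertex i) (vertex (suc i)) → R (vertex i) z ≡ true → 
                Path R (len ∸ suc i) z target → z ≡ vertex (suc i)
  forced-step lost {i} {z} i<len same r Q with z Fin.≟ vertex (suc i)
  ... | yes z≡ = z≡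
  ... | no z≢ with through (vertex (suc i)) (ends₂ same) (fromSource (<⇒≤ i<len)) | through (vertex i) (ends₁ same) Q
    where
    ends₁ : ∀ {x y} → SameEdge a b x y → x ≡ a ⊎ x ≡ b
    ends₁ (inj₁ (p , _)) = inj₁ p
    ends₁ (inj₂ (p , _)) = inj₂ p
    ends₂ : ∀ {x y} → SameEdge a b x y → y ≡ a ⊎ y ≡ b
    ends₂ (inj₁ (_ , q)) = inj₂ q
    ends₂ (inj₂ (_ , q)) = inj₁ q
  ... | inj₁ (j , j′ , eq , A , _) | _ = contradiction (shortest (A ◅◅ toTarget i<len)) (<⇒≱ (begin-strict
    j + (len ∸ suc i)      <⟨ +-monoˡ-< (len ∸ suc i) (s≤s (≤-trans (m≤m+n j j′) (≤-reflexive eq))) ⟩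
    suc i + (len ∸ suc i)  ≡⟨ m+[n∸m]≡n i<len ⟩
    len                    ∎))
    where open ≤-Reasoning
  ... | _ | inj₁ (j , j′ , eq , _ , B) = contradiction (shortest (fromSource (<⇒≤ i<len) ◅◅ B)) (<⇒≱ (begin-strict
    i + j′                 ≤⟨ +-monoʳ-≤ i (≤-trans (m≤n+m j′ j) (≤-reflexive eq)) ⟩
    i + (len ∸ suc i)      <⟨ n<1+n _ ⟩
    suc i + (len ∸ suc i)  ≡⟨ m+[n∸m]≡n i<len ⟩
    len                    ∎))
    where open ≤-Reasoning
  ... | inj₂ A | inj₂ B = contradiction
    (subst (λ k → Path (delete a b R) k source target) (trans (+-suc i _) (m+[n∸m]≡n i<len))
      (A ◅◅ cons (delete⁺ R _ _ r (avoid same z≢)) B)) lost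
    where
    avoid : ∀ {x y} → SameEdge a b x y → z ≢ y → ¬ SameEdge a b x z
    avoid (inj₁ (refl , refl)) z≢y (inj₁ (_ , z≡)) = z≢y z≡
    avoid (inj₁ (refl , refl)) z≢y (inj₂ (refl , z≡)) = z≢y z≡
    avoid (inj₂ (refl , refl)) z≢y (inj₁ (refl , z≡)) = z≢y z≡
    avoid (inj₂ (refl , refl)) z≢y (inj₂ (_ , z≡)) = z≢y z≡

-- A pair with no path in `G` has no distance and imposes nothing. In a subgraph of `G`, a path of
-- length `k` is automatically shortest.
Preserves : Adjacency n → Adjacency n → Pair n → Set
Preserves G R (u , v) = ∀ {k} → IsDistance G u v k → Path R k u v

preserves? : (G R : Adjacency n) → Decidable (Preserves G R)
preserves? G R (u , v) with distance? G u v
... | no ¬d = yes λ d → contradiction (_ , d) ¬d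
... | yes (k , d) = map′ (λ P d′ → subst (λ j → Path R j u v) (distance-unique d d′) P) (λ pres → pres d) (path? R k u v)

preserves-mono : ∀ {G : Adjacency n} → R ⊆ᴬ R′ → ∀ {q} → Preserves G R q → Preserves G R′ q
preserves-mono R⊆ pres d = Path-mono R⊆ (pres d)

-- Criticality is claimed only for the edges in `tested`, which lets `prune` recurse on that list.
record Minimal (G : Adjacency n) (P : List (Pair n)) (tested : List (Pair n)) (R₀ : Adjacency n) : Set where
  field
    subgraph   : Adjacency n
    ⊆start     : subgraph ⊆ᴬ R₀
    symmetric  : Symmetric subgraph
    preserves  : All (Preserves G subgraph) P
    critical   : ∀ {a b} → (a , b) ∈ tested → subgraph a b ≡ true → ¬ All (Preserves G (delete a b subgraph)) P

-- One pass suffices: an edge that cannot be deleted now cannot be deleted from a smaller subgraph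
-- either, since preservation is monotone.
prune : (G : Adjacency n) (P tested : List (Pair n)) (R₀ : Adjacency n) →
        Symmetric R₀ → All (Preserves G R₀) P → Minimal G P tested R₀
prune G P [] R₀ R₀-sym pres = record
  { subgraph = R₀ ; ⊆start = λ r → r ; symmetric = R₀-sym ; preserves = pres ; critical = λ () }
prune G P ((a , b) ∷ tested) R₀ R₀-sym pres with all? (preserves? G (delete a b R₀)) P
... | yes pres′ = record
  { subgraph = subgraph
  ; ⊆start = λ {u} {v} r → delete-⊆ R₀ a b {u} {v} (⊆start r)
  ; symmetric = symmetric
  ; preserves = preserves
  ; critical = λ where
      (here refl) r → contradiction (inj₁ (refl , refl)) (delete⁻ R₀ a b (⊆start r))
      (there x) → critical x }
  where open Minimal (prune G P tested (delete a b R₀) (λ {u} {v} → delete-sym R₀ a b R₀-sym {u} {v}) pres′)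
... | no ¬pres = record
  { subgraph = subgraph
  ; ⊆start = ⊆start
  ; symmetric = symmetric
  ; preserves = preserves
  ; critical = λ where
      (here refl) _ pres′ → ¬pres (All.map (λ {q} →
        preserves-mono (λ {u} {v} → delete-mono {R = subgraph} {R′ = R₀} ⊆start {u} {v}) {q}) pres′)
      (there x) → critical x }
  where open Minimal (prune G P tested R₀ R₀-sym pres)

-- Arithmetic

^-cancel-≤ : ∀ k {x y} → x ^ suc k ≤ y ^ suc k → x ≤ y
^-cancel-≤ k {x} {y} le = ≮⇒≥ λ y<x → <⇒≱ (^-monoˡ-< (suc k) y<x) le

module _ {n p m S D a b : ℕ} .{{_ : NonZero D}}
  (m²≤ : m * m ≤ p * (S + S)) (S²≤ : D * (S * S) ≤ n * n * (S * 5 + m * D * 5))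
  (a-bound : n ^ 2 * p ^ 2 ≤ a ^ 3) (b-bound : n ^ 3 * p ≤ b ^ 3) (b≤nD : b ≤ n * D) where

  open +-*-Solver
  open ≤-Reasoning

  -- Here S² ≤ 10 n² m, so m⁴ ≤ 4 p² S² ≤ 40 m n² p²; the constant 40 is raised to 64 = 4³ to obtain
  -- a cube.
  few-ordered⇒ : S ≤ m * D → m ≤ 4 * a
  few-ordered⇒ S≤ with m ≟ 0
  ... | yes m≡0 = ≤-trans (≤-reflexive m≡0) z≤n
  ... | no  m≢0 = ^-cancel-≤ 2 (*-cancelˡ-≤ m {{≢-nonZero m≢0}} (begin
    m * m ^ 3                          ≡⟨ solve 1 (λ m → m :* m :^ 3 := (m :* m) :* (m :* m)) refl m ⟩
    (m * m) * (m * m)                  ≤⟨ *-mono-≤ m²≤ m²≤ ⟩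
    p * (S + S) * (p * (S + S))
      ≡⟨ solve 2 (λ p S → p :* (S :+ S) :* (p :* (S :+ S)) := con 4 :* p :^ 2 :* (S :* S)) refl p S ⟩
    4 * p ^ 2 * (S * S)                ≤⟨ *-monoʳ-≤ (4 * p ^ 2) S² ⟩
    4 * p ^ 2 * (n * n * (m * 10))
      ≡⟨ solve 3 (λ p n m → con 4 :* p :^ 2 :* (n :* n :* (m :* con 10)) := m :* (con 40 :* (n :^ 2 :* p :^ 2))) refl p n m ⟩
    m * (40 * (n ^ 2 * p ^ 2))         ≤⟨ *-monoʳ-≤ m (*-mono-≤ (m≤m+n 40 24) a-bound) ⟩
    m * (64 * a ^ 3)                   ≡⟨ cong (m *_) (solve 1 (λ a → con 64 :* a :^ 3 := (con 4 :* a) :^ 3) refl a) ⟩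
    m * (4 * a) ^ 3                    ∎))
    where
    S² : S * S ≤ n * n * (m * 10)
    S² = *-cancelˡ-≤ D (begin
      D * (S * S)                        ≤⟨ S²≤ ⟩
      n * n * (S * 5 + m * D * 5)        ≤⟨ *-monoʳ-≤ (n * n) (+-monoˡ-≤ (m * D * 5) (*-monoˡ-≤ 5 S≤)) ⟩
      n * n * (m * D * 5 + m * D * 5)
        ≡⟨ solve 3 (λ n m D → n :* n :* (m :* D :* con 5 :+ m :* D :* con 5) := D :* (n :* n :* (m :* con 10))) refl n m D ⟩
      D * (n * n * (m * 10))             ∎)

  -- Here D S ≤ 10 n², so b m² ≤ n D m² ≤ 20 n³ p ≤ 20 b³; the constant 20 is raised to 25 = 5² to
  -- obtain a square.
  many-ordered⇒ : .{{NonZero b}} → m * D ≤ S → m ≤ 5 * b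
  many-ordered⇒ mD≤ = ^-cancel-≤ 1 (*-cancelˡ-≤ b (begin
    b * m ^ 2                     ≤⟨ *-monoˡ-≤ (m ^ 2) b≤nD ⟩
    n * D * m ^ 2                 ≡⟨ solve 3 (λ n D m → n :* D :* m :^ 2 := n :* (D :* (m :* m))) refl n D m ⟩
    n * (D * (m * m))             ≤⟨ *-monoʳ-≤ n (*-monoʳ-≤ D m²≤) ⟩
    n * (D * (p * (S + S)))
      ≡⟨ solve 4 (λ n D p S → n :* (D :* (p :* (S :+ S))) := n :* p :* con 2 :* (D :* S)) refl n D p S ⟩
    n * p * 2 * (D * S)           ≤⟨ *-monoʳ-≤ (n * p * 2) DS≤ ⟩
    n * p * 2 * (n * n * 10)
      ≡⟨ solve 2 (λ n p → n :* p :* con 2 :* (n :* n :* con 10) := con 20 :* (n :^ 3 :* p)) refl n p ⟩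
    20 * (n ^ 3 * p)              ≤⟨ *-mono-≤ (m≤m+n 20 5) b-bound ⟩
    25 * b ^ 3                    ≡⟨ solve 1 (λ b → con 25 :* b :^ 3 := b :* (con 5 :* b) :^ 2) refl b ⟩
    b * (5 * b) ^ 2               ∎))
    where
    DS≤ : D * S ≤ n * n * 10
    DS≤ with S ≟ 0
    ... | yes S≡0 = ≤-trans (≤-reflexive (trans (cong (D *_) S≡0) (*-zeroʳ D))) z≤n
    ... | no  S≢0 = *-cancelʳ-≤ (D * S) (n * n * 10) S {{≢-nonZero S≢0}} (begin
      D * S * S                      ≡⟨ *-assoc D S S ⟩
      D * (S * S)                    ≤⟨ S²≤ ⟩
      n * n * (S * 5 + m * D * 5)    ≤⟨ *-monoʳ-≤ (n * n) (+-monoʳ-≤ (S * 5) (*-monoˡ-≤ 5 mD≤)) ⟩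
      n * n * (S * 5 + S * 5)
        ≡⟨ solve 2 (λ n S → n :* n :* (S :* con 5 :+ S :* con 5) := n :* n :* con 10 :* S) refl n S ⟩
      n * n * 10 * S                 ∎)

  clustered-bound : .{{NonZero b}} → m ≤ 4 * a + 5 * b
  clustered-bound with ≤-total S (m * D)
  ... | inj₁ S≤ = ≤-trans (few-ordered⇒ S≤) (m≤m+n (4 * a) (5 * b))
  ... | inj₂ ≤S = ≤-trans (many-ordered⇒ ≤S) (m≤n+m (5 * b) (4 * a))

-- The cluster size `suc (b / n)` is positive; its lower bound serves the clustered edges, its upper
-- bound the others.
threshold : ∀ b n .{{_ : NonZero n}} → b ≤ n * suc (b / n) × n * suc (b / n) ≤ b + n
threshold b n = lower , upper
  where
  open ≤-Reasoning
  lower : b ≤ n * suc (b / n)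
  lower = begin
    b                        ≡⟨ m≡m%n+[m/n]*n b n ⟩
    b % n + b / n * n        ≤⟨ +-monoˡ-≤ (b / n * n) (<⇒≤ (m%n<n b n)) ⟩
    suc (b / n) * n          ≡⟨ *-comm (suc (b / n)) n ⟩
    n * suc (b / n)          ∎
  upper : n * suc (b / n) ≤ b + n
  upper = begin
    n * suc (b / n)          ≡⟨ *-comm n (suc (b / n)) ⟩
    n + b / n * n            ≤⟨ +-monoʳ-≤ n (m/n*n≤m b n) ⟩
    n + b                    ≡⟨ +-comm n b ⟩
    b + n                    ∎

-- Lets the rounding error `n` of `threshold` be absorbed in the bound.
n≤b : ∀ {n p b} .{{_ : NonZero p}} → n ^ 3 * p ≤ b ^ 3 → n ≤ b
n≤b {n} {p} le = ^-cancel-≤ 2 (≤-trans (m≤m*n (n ^ 3) p) le)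

-- The preserver as a tiebreaking scheme

vertices : {R : Adjacency n} → Path R k u v → List (Fin n)
vertices {u = u} nil        = u ∷ []
vertices {u = u} (cons r P) = u ∷ vertices P

length-vertices : (P : Path R k u v) → length (vertices P) ≡ suc k
length-vertices nil        = refl
length-vertices (cons r P) = cong suc (length-vertices P)

path⇒walk : ∀ {G : Graph n} → R ⊆ᴬ Adj G → (P : Path R k u v) → Walk G u v (vertices P)
path⇒walk R⊆ nil        = Walk.here
path⇒walk R⊆ (cons r P) = Walk.step (R⊆ r) (path⇒walk R⊆ P)

walk⇒path : ∀ {G : Graph n} {xs} → Walk G u v xs → ∃[ k ] Path (Adj G) k u v × length xs ≡ suc k
walk⇒path Walk.here = 0 , nil , refl
walk⇒path (Walk.step r W) with k , P , eq ← walk⇒path W = suc k , cons r P , cong suc eq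

vertices-head : ∀ {x xs} (P : Path R k u v) → vertices P ≡ x ∷ xs → u ≡ x
vertices-head nil        eq = ∷-injectiveˡ eq
vertices-head (cons _ _) eq = ∷-injectiveˡ eq

consecutive⇒edge : {R : Adjacency n} (P : Path R k u v) → Consecutive a b (vertices P) → R a b ≡ true
consecutive⇒edge nil (_ ∷ [] , _ , ())
consecutive⇒edge nil (_ ∷ _ ∷ _ , _ , ())
consecutive⇒edge {R = R} (cons r P) ([] , zs , eq) =
  subst₂ (λ x y → R x y ≡ true) (∷-injectiveˡ eq) (vertices-head P (∷-injectiveʳ eq)) r
consecutive⇒edge (cons r P) (_ ∷ ys , zs , eq) = consecutive⇒edge P (ys , zs , ∷-injectiveʳ eq)

MinimalSubgraph : (G : Graph n) (P : List (Pair n)) → Set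
MinimalSubgraph {n} G P = Minimal (Adj G) P (cartesianProduct (allFin n) (allFin n)) (Adj G)

minimalSubgraph : (G : Graph n) (P : List (Pair n)) → MinimalSubgraph G P
minimalSubgraph G P = prune (Adj G) P _ (Adj G) (λ {u} {v} r → trans (Graph.sym G v u) r) (All.tabulate λ _ → proj₁)

module Preserver {n} (G : Graph n) (P : List (Pair n)) (min : MinimalSubgraph G P) where

  open Minimal min
    renaming (subgraph to H; ⊆start to H⊆G; symmetric to H-sym)

  -- The length is the distance in `G`, the path is sought in `H`. The last branch is a default for
  -- pairs that `H` does not preserve, hence never for pairs in `P`.
  ρ : Pair n → List (Fin n)
  ρ (u , v) with distance? (Adj G) u v
  ... | no _ = []
  ... | yes (k , _) with path? H k u v
  ...   | yes Q = vertices Q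
  ...   | no _  = []

  ρ-tiebreaking : IsTiebreaking G P ρ
  ρ-tiebreaking {u} {v} uv∈P with distance? (Adj G) u v
  ... | no unreachable = (λ (xs , W) → contradiction (reach W) unreachable) , λ _ → refl
    where
    reach : ∀ {xs} → Walk G u v xs → ∃ (IsDistance (Adj G) u v)
    reach W with k , Q , _ ← walk⇒path W with distance≤? (Adj G) u v k
    ... | inj₁ d    = d
    ... | inj₂ none = contradiction Q (none ≤-refl)
  ... | yes (k , d) with path? H k u v
  ...   | no ¬Q = contradiction (All.lookup preserves uv∈P d) ¬Q
  ...   | yes Q = (λ _ → path⇒walk H⊆G Q , shortest) , λ ¬reach → contradiction (_ , path⇒walk H⊆G Q) ¬reach
    where
    shortest : ∀ ys → Walk G u v ys → length (vertices Q) ≤ length ys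
    shortest ys W with j , Q′ , eq ← walk⇒path W =
      subst₂ _≤_ (sym (length-vertices Q)) (sym eq) (s≤s (proj₂ d Q′))

  ρ⊆H : ∀ q → Consecutive a b (ρ q) → H a b ≡ true
  ρ⊆H (u , v) c with distance? (Adj G) u v
  ρ⊆H (u , v) ([] , _ , ()) | no _
  ρ⊆H (u , v) (_ ∷ _ , _ , ()) | no _
  ρ⊆H (u , v) c | yes (k , _) with path? H k u v
  ρ⊆H (u , v) c | yes (k , _) | yes Q = consecutive⇒edge Q c
  ρ⊆H (u , v) ([] , _ , ()) | yes (k , _) | no _
  ρ⊆H (u , v) (_ ∷ _ , _ , ()) | yes (k , _) | no _

  union⊆H : InUnion P ρ (a , b) → H a b ≡ true
  union⊆H (_ , q , _ , inj₁ c) = ρ⊆H q c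
  union⊆H (_ , q , _ , inj₂ c) = H-sym (ρ⊆H q c)

  -- Owners for the edges of the preserver

  Connected : Pair n → Set
  Connected (u , v) = ∃ (IsDistance (Adj G) u v)

  connected? : Decidable Connected
  connected? (u , v) = distance? (Adj G) u v

  connectedPairs : List (Pair n)
  connectedPairs = filter connected? P

  route : Fin (length connectedPairs) → Geodesic H
  route i with q∈P , k , d ← ∈-filter⁻ connected? {xs = P} (∈-lookup {xs = connectedPairs} i) = record
    { path = All.lookup preserves q∈P d
    ; shortest = λ Q → proj₂ d (Path-mono H⊆G Q) }

  -- The length of a route is the distance in `G`, so a path of that length would preserve the pair.
  lost-route : ∀ {R : Adjacency n} i → ¬ Preserves (Adj G) R (lookup connectedPairs i) →
               ¬ Path R (Geodesic.len (route i)) (Geodesic.source (route i)) (Geodesic.target (route i))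
  lost-route {R} i ¬pres Q with q∈P , k , d ← ∈-filter⁻ connected? {xs = P} (∈-lookup {xs = connectedPairs} i) =
    ¬pres λ d′ → subst (λ j → Path R j _ _) (distance-unique d d′) Q

  record Owned (a b : Fin n) : Set where
    field
      owner : Fin (length connectedPairs)
    open Geodesic (route owner)
    field
      pos    : ℕ
      pos<   : pos < len
      ends   : SameEdge a b (vertex pos) (vertex (suc pos))
      forced : ∀ {z} → H (vertex pos) z ≡ true → Path H (len ∸ suc pos) z target → z ≡ vertex (suc pos)

  -- By minimality, deleting the edge violates some pair of `P`. The route of that pair must use the
  -- edge, or it would survive, and `forced-step` applies at that place.
  owned : H a b ≡ true → Owned a b
  owned {a} {b} r
    with q , q∈P , ¬pres ← find (¬All⇒Any¬ (preserves? (Adj G) (delete a b H)) P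
                                  (critical (∈-cartesianProduct⁺ (∈-allFin a) (∈-allFin b)) r))
    = build (locate a b (Geodesic.path (route i)))
    where
    -- A disconnected pair is preserved vacuously, so the violated pair is connected.
    connected : Connected q
    connected with connected? q
    ... | yes d = d
    ... | no ¬d = ⊥-elim (¬pres λ d → contradiction (_ , d) ¬d)
    q∈ : q ∈ connectedPairs
    q∈ = ∈-filter⁺ connected? q∈P connected
    i = index q∈
    lost = lost-route {delete a b H} i (subst (λ q → ¬ Preserves (Adj G) (delete a b H) q) (lookup-index q∈) ¬pres)
    build : _ ⊎ _ → Owned a b
    build (inj₁ (j , j< , same)) = record
      { owner = i ; pos = j ; pos< = j< ; ends = same ; forced = forced-step (route i) lost j< same }
    build (inj₂ Q) = contradiction Q lost

  module _ {es : List (Pair n)} (es! : Unique es)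
    (edges : ∀ {a b} → (a , b) ∈ es → a Data.Fin.< b × H a b ≡ true) where

    ownedAt : ∀ e → Owned (proj₁ (lookup es e)) (proj₂ (lookup es e))
    ownedAt e = owned (proj₂ (edges (∈-lookup e)))

    criticalEdges : CriticalEdges H (length connectedPairs) (length es)
    criticalEdges = record
      { route = route
      ; owner = λ e → Owned.owner (ownedAt e)
      ; pos   = λ e → Owned.pos (ownedAt e)
      ; pos<  = λ e → Owned.pos< (ownedAt e)
      ; distinct = λ {e} {f} t h → Unique-lookup es! e f
          (unordered (proj₁ (edges (∈-lookup e))) (proj₁ (edges (∈-lookup f)))
            (Owned.ends (ownedAt e)) (Owned.ends (ownedAt f)) t h)
      ; forced = λ e → Owned.forced (ownedAt e) }
      where
      -- Routes may traverse an edge either way; opposite orientations contradict the normalisation.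
      unordered : ∀ {a b c d x y x′ y′} → a Data.Fin.< b → c Data.Fin.< d → SameEdge a b x y → SameEdge {n} c d x′ y′ →
                  x ≡ x′ → y ≡ y′ → (a , b) ≡ (c , d)
      unordered _   _   (inj₁ (refl , refl)) (inj₁ (refl , refl)) refl refl = refl
      unordered a<b c<d (inj₁ (refl , refl)) (inj₂ (refl , refl)) refl refl = contradiction c<d (<-asym a<b)
      unordered a<b c<d (inj₂ (refl , refl)) (inj₁ (refl , refl)) refl refl = contradiction c<d (<-asym a<b)
      unordered _   _   (inj₂ (refl , refl)) (inj₂ (refl , refl)) refl refl = refl

  module _ {x y : ℕ} .{{_ : NonZero n}} .{{_ : NonZero (length P)}}
    (x-bound : n ^ 2 * length P ^ 2 ≤ x ^ 3) (y-bound : n ^ 3 * length P ≤ y ^ 3) where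

    -- The cluster size depends on `y`, but `H` and `ρ` do not, so one scheme serves all admissible
    -- bounds.
    D : ℕ
    D = suc (y / n)

    n≤y : n ≤ y
    n≤y = n≤b y-bound

    module _ {N} (C : Clusters H D N) {es : List (Pair n)} (es! : Unique es)
      (edges : ∀ {a b} → (a , b) ∈ es → (a Data.Fin.< b × H a b ≡ true) × Clustered C a × Clustered C b) where

      headClustered : ∀ e → Clustered C (CriticalEdges.head (criticalEdges es! (proj₁ ∘ edges)) e)
      headClustered e = end (Owned.ends (ownedAt es! (proj₁ ∘ edges) e)) (proj₂ (edges (∈-lookup e)))
        where
        end : ∀ {a b x y} → SameEdge a b x y → Clustered C a × Clustered C b → Clustered C y
        end (inj₁ (_ , refl)) (_ , b∈) = b∈
        end (inj₂ (_ , refl)) (a∈ , _) = a∈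

      clusteredEdges≤ : length es ≤ 4 * x + 5 * y
      clusteredEdges≤ = bound (ordered-pairs (criticalEdges es! (proj₁ ∘ edges)) C headClustered)
        where
        m = length es
        p = length connectedPairs
        bound : ∃[ S ] m * m ≤ p * (S + S) × D * (S * S) ≤ n * n * (S * 5 + m * D * 5) → m ≤ 4 * x + 5 * y
        bound (S , m²≤ , S²≤) = clustered-bound {n} {p} {m} {S} {D} {x} {y} m²≤ S²≤
          -- There are at most |P| owners, so the bounds assumed for |P| hold for `p`.
          (≤-trans (*-monoʳ-≤ (n ^ 2) (^-monoˡ-≤ 2 (length-filter connected? P))) x-bound)
          (≤-trans (*-monoʳ-≤ (n ^ 3) (length-filter connected? P)) y-bound)
          (proj₁ (threshold y n)) {{>-nonZero (<-≤-trans (>-nonZero⁻¹ n) n≤y)}}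

    splitEdges≤ : ∀ {N} (C : Clusters H D N) → (∀ c → length (freeNeighbours C c) < D) → ∀ {es} → Unique es →
                  (∀ {a b} → (a , b) ∈ es → a Data.Fin.< b × H a b ≡ true) → length es ≤ 7 * (x + y)
    splitEdges≤ C sparse {es} es! edges = begin
      length es                                         ≡⟨ length-filter-¬ both? es ⟩
      length (filter both? es) + length (filter (¬? ∘ both?) es)
        ≤⟨ +-mono-≤ (clusteredEdges≤ C (filter⁺ both? es!) inside)
                    (freeEdges≤ C sparse H-sym (filter⁺ (¬? ∘ both?) es!) outside) ⟩
      4 * x + 5 * y + n * D
        ≤⟨ +-monoʳ-≤ (4 * x + 5 * y) (≤-trans (proj₂ (threshold y n)) (+-monoʳ-≤ y n≤y)) ⟩
      -- Adding `3 * x` makes both coefficients 7.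
      4 * x + 5 * y + (y + y)                           ≤⟨ m≤m+n _ (3 * x) ⟩
      4 * x + 5 * y + (y + y) + 3 * x
        ≡⟨ solve 2 (λ x y → con 4 :* x :+ con 5 :* y :+ (y :+ y) :+ con 3 :* x := con 7 :* (x :+ y)) refl x y ⟩
      7 * (x + y)                                       ∎
      where
      open ≤-Reasoning
      open +-*-Solver
      both? = BothClustered? C
      inside : ∀ {a b} → (a , b) ∈ filter both? es → (a Data.Fin.< b × H a b ≡ true) × Clustered C a × Clustered C b
      inside e with e∈ , both ← ∈-filter⁻ both? {xs = es} e = edges e∈ , both
      outside : ∀ {a b} → (a , b) ∈ filter (¬? ∘ both?) es → a Data.Fin.< b × H a b ≡ true × ¬ BothClustered C (a , b)
      outside e with e∈ , ¬both ← ∈-filter⁻ (¬? ∘ both?) {xs = es} e with a<b , r ← edges e∈ = a<b , r , ¬both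

    edges≤ : ∀ {es} → Unique es → (∀ {a b} → (a , b) ∈ es → a Data.Fin.< b × H a b ≡ true) → length es ≤ 7 * (x + y)
    edges≤ = let _ , C , sparse = maximalClusters H-sym D in splitEdges≤ C sparse

-- Fractional powers are avoided by cubing: `a` and `b` are any integers above n^(2/3)|P|^(2/3) and
-- n|P|^(1/3).
theorem3 : ∃[ C ] (∀ (n : ℕ) (G : Graph n) (P : List (Pair n)) → Unique P →
    ∃[ ρ ] (IsTiebreaking G P ρ ×
    (∀ (a b : ℕ) → n ^ 2 * length P ^ 2 ≤ a ^ 3 →
    n ^ 3 * length P ≤ b ^ 3 →
    UnionSizeAtMost P ρ (C * (a + b)))))
theorem3 = 7 , λ n G P _ →
  let open Preserver G P (minimalSubgraph G P) in ρ , ρ-tiebreaking , bound G P (minimalSubgraph G P)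
  where
  bound : ∀ {n} (G : Graph n) (P : List (Pair n)) (min : MinimalSubgraph G P) (a b : ℕ) →
          n ^ 2 * length P ^ 2 ≤ a ^ 3 → n ^ 3 * length P ≤ b ^ 3 →
          UnionSizeAtMost P (Preserver.ρ G P min) (7 * (a + b))
  -- An edge of the union needs a vertex and a pair, so a nonempty `es` makes `n` and `length P`
  -- nonzero.
  bound G P min a b _ _ [] _ _ = z≤n
  bound {suc _} G P@(_ ∷ _) min a b a-bound b-bound es es! inUnion =
    edges≤ {a} {b} a-bound b-bound es! λ e → proj₁ (All.lookup inUnion e) , union⊆H (All.lookup inUnion e)
    where open Preserver G P min
  bound {suc _} G [] min a b _ _ (_ ∷ _) _ ((_ , _ , () , _) All.∷ _)
  bound {zero} G P min a b _ _ ((() , _) ∷ _) _ _
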